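{- Let $N>0$ be an integer. Then for every integer $n\ge 0$, $$\sum_{i=0}^{4N+1} F(n+i) = L(2N+1)\,F(n+2N+2).$$
   Context: The Fibonacci numbers are defined by $F(0)=0$, $F(1)=1$, $F(n)=F(n-1)+F(n-2)$ for $n\ge 2$. The Lucas numbers are defined by $L(0)=2$, $L(1)=1$, $L(n)=L(n-1)+L(n-2)$ for $n\ge 2$. -}

module Defs where

open import Data.Nat using (ℕ; zero; suc; _+_)

F : ℕ → ℕ
F zero          = 0
F (suc zero)    = 1
F (suc (suc n)) = F (suc n) + F n

L : ℕ → ℕ
L zero          = 2
L (suc zero)    = 1
L (suc (suc n)) = L (suc n) + L n

{-# OPTIONS --safe #-}
-- A sum of consecutive terms of a Fibonacci sequence telescopes, so the left-hand side is
-- F(n+4N+3) − F(n+1).  With k = 2N+1 and a = n+1 this is F(a+2k) − F(a), and the theorem is the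
-- odd case of F(a+2k) + (−1)ᵏ F(a) = L(k) F(a+k).  That identity follows by a two-step induction
-- on k: add the instances (k, a+2) and (k+1, a+1), whose middle indices both equal a+k+2.
module Submission where

open import Defs
open import Data.Nat using (ℕ; zero; suc; _+_; _*_; _<_)
open import Data.Nat.Properties using (+-suc; +-identityʳ; +-cancelʳ-≡; *-distribʳ-+)
open import Data.Nat.Tactic.RingSolver using (solve-∀)
open import Data.List using (map; upTo; applyUpTo)
open import Data.List.Properties using (map-upTo)
open import Data.Nat.ListAction using (sum)
open import Data.Product using (_×_; _,_; proj₂)
open import Relation.Binary.PropositionalEquality
  using (_≡_; refl; sym; cong; cong₂; module ≡-Reasoning)

open ≡-Reasoning

-- Peeling off the first term leaves the shifted sequence, and `f 0 + f 1 = f 2` is exactly the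
-- correction term that this sequence needs. Hence the induction on `m` must let `f` vary.
sum-fibonacci : (f : ℕ → ℕ) → (∀ i → f (2 + i) ≡ f (1 + i) + f i) →
  ∀ m → sum (applyUpTo f m) + f 1 ≡ f (1 + m)
sum-fibonacci f rec zero    = refl
sum-fibonacci f rec (suc m) = begin
  f 0 + s + f 1    ≡⟨ shuffle (f 0) s (f 1) ⟩
  s + (f 1 + f 0)  ≡⟨ cong (s +_) (rec 0) ⟨
  s + f 2          ≡⟨ sum-fibonacci (λ i → f (suc i)) (λ i → rec (suc i)) m ⟩
  f (2 + m)        ∎
  where
  s = sum (applyUpTo (λ i → f (suc i)) m)
  shuffle : ∀ x y z → x + y + z ≡ y + (z + x)
  shuffle = solve-∀

F-shift : ∀ n i → F (n + (2 + i)) ≡ F (n + (1 + i)) + F (n + i)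
F-shift n i rewrite +-suc n (suc i) | +-suc n i = refl

-- The sign (-1)ᵏ is split by parity, with `F a` put on the side where it is positive, so that
-- everything stays in `ℕ`.
EvenIdentity OddIdentity : ℕ → Set
EvenIdentity k = ∀ a → F (k + k + a) + F a ≡ L k * F (k + a)
OddIdentity  k = ∀ a → F (k + k + a) ≡ L k * F (k + a) + F a

F-outer : ∀ k a →
  F ((2 + k) + (2 + k) + a) ≡ F ((1 + k) + (1 + k) + (1 + a)) + F (k + k + (2 + a))
F-outer k a = cong₂ (λ i j → F i + F j) (index₁ k a) (index₀ k a)
  where
  index₁ : ∀ k a → 1 + (k + (2 + k) + a) ≡ (1 + k) + (1 + k) + (1 + a)
  index₁ = solve-∀
  index₀ : ∀ k a → k + (2 + k) + a ≡ k + k + (2 + a)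
  index₀ = solve-∀

L*F-middle : ∀ k a →
  L (1 + k) * F ((1 + k) + (1 + a)) + L k * F (k + (2 + a)) ≡ L (2 + k) * F ((2 + k) + a)
L*F-middle k a = begin
  L (1 + k) * F ((1 + k) + (1 + a)) + L k * F (k + (2 + a))
    ≡⟨ cong₂ (λ i j → L (1 + k) * F i + L k * F j) (index₁ k a) (index₀ k a) ⟩
  L (1 + k) * F ((2 + k) + a) + L k * F ((2 + k) + a)
    ≡⟨ *-distribʳ-+ (F ((2 + k) + a)) (L (1 + k)) (L k) ⟨
  L (2 + k) * F ((2 + k) + a) ∎
  where
  index₁ : ∀ k a → (1 + k) + (1 + a) ≡ (2 + k) + a
  index₁ = solve-∀
  index₀ : ∀ k a → k + (2 + a) ≡ (2 + k) + a
  index₀ = solve-∀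

even-step : ∀ k → EvenIdentity k → OddIdentity (1 + k) → EvenIdentity (2 + k)
even-step k even odd a = begin
  F ((2 + k) + (2 + k) + a) + F a  ≡⟨ cong (_+ F a) (F-outer k a) ⟩
  y + x + F a                      ≡⟨ cong (λ z → z + x + F a) (odd (1 + a)) ⟩
  -- The remainder `F (1 + a)` of the odd instance and the `F a` of the goal merge into `F (2 + a)`,
  -- the term that the even instance absorbs.
  p + F (1 + a) + x + F a          ≡⟨ shuffle p (F (1 + a)) x (F a) ⟩
  p + (x + F (2 + a))              ≡⟨ cong (p +_) (even (2 + a)) ⟩
  p + L k * F (k + (2 + a))        ≡⟨ L*F-middle k a ⟩
  L (2 + k) * F ((2 + k) + a)      ∎
  where
  x = F (k + k + (2 + a))
  y = F ((1 + k) + (1 + k) + (1 + a))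
  p = L (1 + k) * F ((1 + k) + (1 + a))
  shuffle : ∀ p u x v → p + u + x + v ≡ p + (x + (u + v))
  shuffle = solve-∀

odd-step : ∀ k → OddIdentity k → EvenIdentity (1 + k) → OddIdentity (2 + k)
odd-step k odd even a = begin
  F ((2 + k) + (2 + k) + a)                        ≡⟨ F-outer k a ⟩
  y + F (k + k + (2 + a))                          ≡⟨ cong (y +_) (odd (2 + a)) ⟩
  -- Conversely, `F (2 + a)` splits: `F (1 + a)` completes the even instance, and `F a` survives as
  -- the remainder.
  y + (q + F (2 + a))                              ≡⟨ shuffle y q (F (1 + a)) (F a) ⟩
  y + F (1 + a) + q + F a                          ≡⟨ cong (λ z → z + q + F a) (even (1 + a)) ⟩
  L (1 + k) * F ((1 + k) + (1 + a)) + q + F a      ≡⟨ cong (_+ F a) (L*F-middle k a) ⟩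
  L (2 + k) * F ((2 + k) + a) + F a                ∎
  where
  y = F ((1 + k) + (1 + k) + (1 + a))
  q = L k * F (k + (2 + a))
  shuffle : ∀ y q u v → y + (q + (u + v)) ≡ y + u + q + v
  shuffle = solve-∀

-- Each step needs both parities, so they advance as a pair, the new even case feeding the odd one.
-- Writing `N * 2` lets `suc N * 2` compute to `2 + N * 2`.
even-odd-identities : ∀ N → EvenIdentity (N * 2) × OddIdentity (1 + N * 2)
even-odd-identities zero = (λ a → cong (F a +_) (sym (+-identityʳ (F a)))) ,
                           (λ a → cong (_+ F a) (sym (+-identityʳ (F (1 + a)))))
even-odd-identities (suc N) with even , odd ← even-odd-identities N = even′ , odd-step (1 + N * 2) odd even′
  where even′ = even-step (N * 2) even odd

theorem5p1 : ∀ (N : ℕ) → 0 < N → ∀ (n : ℕ) →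
    sum (map (λ i → F (n + i)) (upTo (4 * N + 2))) ≡ L (2 * N + 1) * F (n + 2 * N + 2)
-- `F (n + 1)` is both the correction `f 1` of the telescoped sum and the remainder `F a` of the odd
-- identity, so cancelling it replaces subtraction.
theorem5p1 N _ n = +-cancelʳ-≡ (F (n + 1)) _ _ (begin
  sum (map f (upTo (4 * N + 2))) + F (n + 1)
    ≡⟨ cong (λ l → sum l + F (n + 1)) (map-upTo f (4 * N + 2)) ⟩
  sum (applyUpTo f (4 * N + 2)) + F (n + 1)
    ≡⟨ sum-fibonacci f (F-shift n) (4 * N + 2) ⟩
  F (n + (1 + (4 * N + 2)))
    ≡⟨ cong F (outer N n) ⟩
  F (k + k + (n + 1))
    ≡⟨ proj₂ (even-odd-identities N) (n + 1) ⟩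
  L k * F (k + (n + 1)) + F (n + 1)
    ≡⟨ cong₂ (λ i j → L i * F j + F (n + 1)) (index N) (middle N n) ⟩
  L (2 * N + 1) * F (n + 2 * N + 2) + F (n + 1) ∎)
  where
  f : ℕ → ℕ
  f i = F (n + i)
  k = 1 + N * 2
  outer : ∀ N n → n + (1 + (4 * N + 2)) ≡ (1 + N * 2) + (1 + N * 2) + (n + 1)
  outer = solve-∀
  index : ∀ N → 1 + N * 2 ≡ 2 * N + 1
  index = solve-∀
  middle : ∀ N n → (1 + N * 2) + (n + 1) ≡ n + 2 * N + 2
  middle = solve-∀
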